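{- Let $r \geq 2$ and let $D=\{d_1<d_2<d_3<\dotsb\}$ be an infinite set of positive integers. If there exist a real number $\delta>0$ and a positive integer $N$ such that $$d_{n+1} \geq \left(2+\frac{1}{r-1}+\delta\right)d_n \quad\text{for all } n \geq N,$$ then $D$ is not $r$-accessible; that is, $\operatorname{doa}(D) \leq r-1$.
   Context: An $r$-coloring of a set $A$ is a function $\chi:A\to\{1,\dots,r\}$. For $D\subseteq\mathbb{N}=\{1,2,3,\dots\}$, a $k$-term $D$-diffsequence is a sequence of integers $x_1,\dots,x_k$ with $x_{i+1}-x_i\in D$ for all $1\le i\le k-1$. A set $D\subseteq\mathbb{N}$ is $r$-accessible if for every $r$-coloring of $\mathbb{N}$ and every $k\ge1$ there is a monochromatic $k$-term $D$-diffsequence in $\mathbb{N}$. The degree of accessibility $\operatorname{doa}(D)$ is the greatest positive integer $r$ for which $D$ is $r$-accessible ($\operatorname{doa}(D)=\infty$ if $D$ is $r$-accessible for all $r$). -}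

module Defs where

open import Data.Fin.Base using (Fin; toℕ)
import Data.Integer.Base as ℤ
open ℤ using (ℤ; +_)
open import Data.Irrelevant as Irrelevant using ()
open import Data.Nat.Base as ℕ using (ℕ; suc; NonZero)
import Data.Nat.Properties as ℕ
open import Data.Product.Base using (∃-syntax; _×_; _,_)
open import Data.Rational.Base as ℚ using (ℚ; 0ℚ; 1ℚ; ∣_∣)
import Data.Rational.Properties as ℚ
open import Data.Rational.Solver using (module +-*-Solver)
open import Data.Refinement.Base using (Refinement-syntax; value; _,_)
open import Data.Vec.Functional using (Vector)
open import Function.Base using (_∘_)
open import Level using (Level)
open import Relation.Binary.Construct.Add.Supremum.NonStrict ℕ._≤_ using (_≤⁺_)
open import Relation.Binary.PropositionalEquality
  using (_≡_; refl; sym; cong; subst; module ≡-Reasoning)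
open import Relation.Nullary.Construct.Add.Supremum using (_⁺; [_]; ⊤⁺)
open import Relation.Nullary.Negation.Core using (¬_)
open import Relation.Unary using (Pred; _∈_)

private
  variable
    ℓ : Level

------------------------------------------------------------------------
-- Real numbers, as Cauchy sequences of rationals

IsCauchy : (ℕ → ℚ) → Set
IsCauchy x = ∀ ε → 0ℚ ℚ.< ε →
  ∃[ N ] (∀ m n → N ℕ.≤ m → N ℕ.≤ n → ∣ x m ℚ.- x n ∣ ℚ.< ε)

record ℝ : Set where
  constructor mkℝ
  field
    seq    : ℕ → ℚ
    cauchy : IsCauchy seq

open ℝ public

infix  4 _<ℝ_ _≤ℝ_
infixl 6 _+ℝ_
infixl 7 _*ℝ_

_<ℝ_ : ℝ → ℝ → Set
x <ℝ y = ∃[ ε ] 0ℚ ℚ.< ε ×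
  ∃[ N ] (∀ n → N ℕ.≤ n → seq x n ℚ.+ ε ℚ.≤ seq y n)

_≤ℝ_ : ℝ → ℝ → Set
x ≤ℝ y = ¬ (y <ℝ x)

fromℚ : ℚ → ℝ
fromℚ q = mkℝ (λ _ → q) λ ε 0<ε →
  0 , λ _ _ _ _ → subst (ℚ._< ε) (sym (cong ∣_∣ (ℚ.+-inverseʳ q))) 0<ε

private
  +-rearrange : ∀ a b c d →
    (a ℚ.+ b) ℚ.- (c ℚ.+ d) ≡ (a ℚ.- c) ℚ.+ (b ℚ.- d)
  +-rearrange = solve 4 (λ a b c d →
    (a :+ b) :- (c :+ d) := (a :- c) :+ (b :- d)) refl
    where open +-*-Solver

  *-rearrange : ∀ a b c d →
    (a ℚ.* b) ℚ.- (c ℚ.* d) ≡ a ℚ.* (b ℚ.- d) ℚ.+ d ℚ.* (a ℚ.- c)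
  *-rearrange = solve 4 (λ a b c d →
    (a :* b) :- (c :* d) := a :* (b :- d) :+ d :* (a :- c)) refl
    where open +-*-Solver

  -+-cancel : ∀ a b → (a ℚ.- b) ℚ.+ b ≡ a
  -+-cancel = solve 2 (λ a b → (a :- b) :+ b := a) refl
    where open +-*-Solver

  -- ε splits into two copies of M times some η > 0
  split : ∀ M ε → 0ℚ ℚ.< M → 0ℚ ℚ.< ε →
    ∃[ η ] 0ℚ ℚ.< η × M ℚ.* η ℚ.+ M ℚ.* η ≡ ε
  split M ε 0<M 0<ε = 1/2M ℚ.* ε , ℚ.positive⁻¹ _ {{η-pos}} , eq
    where
    instance
      _ = ℚ.positive 0<M
      _ = ℚ.positive 0<ε
      2M-pos : ℚ.Positive (M ℚ.+ M)
      2M-pos = ℚ.pos+pos⇒pos M M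
      2M≢0 : ℚ.NonZero (M ℚ.+ M)
      2M≢0 = ℚ.pos⇒nonZero (M ℚ.+ M)
    1/2M : ℚ
    1/2M = ℚ.1/ (M ℚ.+ M)
    η-pos : ℚ.Positive (1/2M ℚ.* ε)
    η-pos = ℚ.pos*pos⇒pos 1/2M {{ℚ.1/pos⇒pos (M ℚ.+ M)}} ε
    open ≡-Reasoning
    η = 1/2M ℚ.* ε
    eq : M ℚ.* η ℚ.+ M ℚ.* η ≡ ε
    eq = begin
      M ℚ.* η ℚ.+ M ℚ.* η           ≡⟨ ℚ.*-distribʳ-+ η M M ⟨
      (M ℚ.+ M) ℚ.* η               ≡⟨ ℚ.*-assoc (M ℚ.+ M) 1/2M ε ⟨
      ((M ℚ.+ M) ℚ.* 1/2M) ℚ.* ε    ≡⟨ cong (ℚ._* ε) (ℚ.*-inverseʳ (M ℚ.+ M)) ⟩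
      1ℚ ℚ.* ε                      ≡⟨ ℚ.*-identityˡ ε ⟩
      ε                             ∎

  0<1 : 0ℚ ℚ.< 1ℚ
  0<1 = ℚ.positive⁻¹ 1ℚ

  eventuallyBounded : ∀ {x} → IsCauchy x →
    ∃[ K ] 0ℚ ℚ.< K × ∃[ N ] (∀ n → N ℕ.≤ n → ∣ x n ∣ ℚ.≤ K)
  eventuallyBounded {x} cx with cx 1ℚ 0<1
  ... | N , close = 1ℚ ℚ.+ ∣ x N ∣
    , ℚ.+-mono-<-≤ 0<1 (ℚ.0≤∣p∣ (x N))
    , N , λ n N≤n → begin
        ∣ x n ∣                        ≡⟨ cong ∣_∣ (-+-cancel (x n) (x N)) ⟨
        ∣ (x n ℚ.- x N) ℚ.+ x N ∣      ≤⟨ ℚ.∣p+q∣≤∣p∣+∣q∣ (x n ℚ.- x N) (x N) ⟩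
        ∣ x n ℚ.- x N ∣ ℚ.+ ∣ x N ∣    ≤⟨ ℚ.+-monoˡ-≤ ∣ x N ∣ (ℚ.<⇒≤ (close n N N≤n ℕ.≤-refl)) ⟩
        1ℚ ℚ.+ ∣ x N ∣                 ∎
    where open ℚ.≤-Reasoning

  +-cauchy : ∀ {x y} → IsCauchy x → IsCauchy y → IsCauchy (λ n → x n ℚ.+ y n)
  +-cauchy {x} {y} cx cy ε 0<ε
    with η , 0<η , η+η≡ε ← split 1ℚ ε 0<1 0<ε
    with N₁ , px ← cx η 0<η
    with N₂ , py ← cy η 0<η
    = N₁ ℕ.⊔ N₂ , λ m n N≤m N≤n → begin-strict
        ∣ (x m ℚ.+ y m) ℚ.- (x n ℚ.+ y n) ∣    ≡⟨ cong ∣_∣ (+-rearrange (x m) (y m) (x n) (y n)) ⟩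
        ∣ (x m ℚ.- x n) ℚ.+ (y m ℚ.- y n) ∣    ≤⟨ ℚ.∣p+q∣≤∣p∣+∣q∣ (x m ℚ.- x n) (y m ℚ.- y n) ⟩
        ∣ x m ℚ.- x n ∣ ℚ.+ ∣ y m ℚ.- y n ∣    <⟨ ℚ.+-mono-<
          (px m n (ℕ.m⊔n≤o⇒m≤o N₁ N₂ N≤m) (ℕ.m⊔n≤o⇒m≤o N₁ N₂ N≤n))
          (py m n (ℕ.m⊔n≤o⇒n≤o N₁ N₂ N≤m) (ℕ.m⊔n≤o⇒n≤o N₁ N₂ N≤n)) ⟩
        η ℚ.+ η                                ≡⟨ cong (λ z → z ℚ.+ z) (ℚ.*-identityˡ η) ⟨
        1ℚ ℚ.* η ℚ.+ 1ℚ ℚ.* η                  ≡⟨ η+η≡ε ⟩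
        ε                                      ∎
    where open ℚ.≤-Reasoning

  ∣*∣-bound : ∀ M η a b → 0ℚ ℚ.< M → ∣ a ∣ ℚ.≤ M → ∣ b ∣ ℚ.< η →
    ∣ a ℚ.* b ∣ ℚ.< M ℚ.* η
  ∣*∣-bound M η a b 0<M a≤M b<η = begin-strict
    ∣ a ℚ.* b ∣        ≡⟨ ℚ.∣p*q∣≡∣p∣*∣q∣ a b ⟩
    ∣ a ∣ ℚ.* ∣ b ∣    ≤⟨ ℚ.*-monoʳ-≤-nonNeg ∣ b ∣ {{ℚ.∣-∣-nonNeg b}} a≤M ⟩
    M ℚ.* ∣ b ∣        <⟨ ℚ.*-monoʳ-<-pos M {{ℚ.positive 0<M}} b<η ⟩
    M ℚ.* η            ∎
    where open ℚ.≤-Reasoning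

  *-close : ∀ M η a b c d → 0ℚ ℚ.< M → ∣ a ∣ ℚ.≤ M → ∣ d ∣ ℚ.≤ M →
    ∣ a ℚ.- c ∣ ℚ.< η → ∣ b ℚ.- d ∣ ℚ.< η →
    ∣ (a ℚ.* b) ℚ.- (c ℚ.* d) ∣ ℚ.< M ℚ.* η ℚ.+ M ℚ.* η
  *-close M η a b c d 0<M a≤M d≤M a-c<η b-d<η = begin-strict
    ∣ (a ℚ.* b) ℚ.- (c ℚ.* d) ∣
      ≡⟨ cong ∣_∣ (*-rearrange a b c d) ⟩
    ∣ a ℚ.* (b ℚ.- d) ℚ.+ d ℚ.* (a ℚ.- c) ∣
      ≤⟨ ℚ.∣p+q∣≤∣p∣+∣q∣ (a ℚ.* (b ℚ.- d)) (d ℚ.* (a ℚ.- c)) ⟩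
    ∣ a ℚ.* (b ℚ.- d) ∣ ℚ.+ ∣ d ℚ.* (a ℚ.- c) ∣
      <⟨ ℚ.+-mono-< (∣*∣-bound M η a (b ℚ.- d) 0<M a≤M b-d<η)
                    (∣*∣-bound M η d (a ℚ.- c) 0<M d≤M a-c<η) ⟩
    M ℚ.* η ℚ.+ M ℚ.* η ∎
    where open ℚ.≤-Reasoning

  commonBound : ∀ K L → 0ℚ ℚ.< K → 0ℚ ℚ.< L →
    ∃[ M ] 0ℚ ℚ.< M × K ℚ.≤ M × L ℚ.≤ M
  commonBound K L 0<K 0<L =
    K ℚ.⊔ L , ℚ.<-≤-trans 0<K (ℚ.p≤p⊔q K L) , ℚ.p≤p⊔q K L , ℚ.p≤q⊔p K L

  *-cauchy : ∀ {x y} → IsCauchy x → IsCauchy y → IsCauchy (λ n → x n ℚ.* y n)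
  *-cauchy {x} {y} cx cy ε 0<ε =
    let K , 0<K , N₁ , x≤K   = eventuallyBounded {x} cx
        L , 0<L , N₂ , y≤L   = eventuallyBounded {y} cy
        M , 0<M , K≤M , L≤M  = commonBound K L 0<K 0<L
        η , 0<η , split-ε    = split M ε 0<M 0<ε
        N₃ , px              = cx η 0<η
        N₄ , py              = cy η 0<η
    in (N₁ ℕ.⊔ N₂) ℕ.⊔ (N₃ ℕ.⊔ N₄) , λ m n N≤m N≤n →
      let N₁₂≤m = ℕ.m⊔n≤o⇒m≤o (N₁ ℕ.⊔ N₂) (N₃ ℕ.⊔ N₄) N≤m
          N₃₄≤m = ℕ.m⊔n≤o⇒n≤o (N₁ ℕ.⊔ N₂) (N₃ ℕ.⊔ N₄) N≤m
          N₁₂≤n = ℕ.m⊔n≤o⇒m≤o (N₁ ℕ.⊔ N₂) (N₃ ℕ.⊔ N₄) N≤n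
          N₃₄≤n = ℕ.m⊔n≤o⇒n≤o (N₁ ℕ.⊔ N₂) (N₃ ℕ.⊔ N₄) N≤n
      in subst (∣ (x m ℚ.* y m) ℚ.- (x n ℚ.* y n) ∣ ℚ.<_) split-ε
           (*-close M η (x m) (y m) (x n) (y n) 0<M
             (ℚ.≤-trans (x≤K m (ℕ.m⊔n≤o⇒m≤o N₁ N₂ N₁₂≤m)) K≤M)
             (ℚ.≤-trans (y≤L n (ℕ.m⊔n≤o⇒n≤o N₁ N₂ N₁₂≤n)) L≤M)
             (px m n (ℕ.m⊔n≤o⇒m≤o N₃ N₄ N₃₄≤m) (ℕ.m⊔n≤o⇒m≤o N₃ N₄ N₃₄≤n))
             (py m n (ℕ.m⊔n≤o⇒n≤o N₃ N₄ N₃₄≤m) (ℕ.m⊔n≤o⇒n≤o N₃ N₄ N₃₄≤n)))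

_+ℝ_ : ℝ → ℝ → ℝ
x +ℝ y = mkℝ (λ n → seq x n ℚ.+ seq y n) (+-cauchy {seq x} {seq y} (cauchy x) (cauchy y))

_*ℝ_ : ℝ → ℝ → ℝ
x *ℝ y = mkℝ (λ n → seq x n ℚ.* seq y n) (*-cauchy {seq x} {seq y} (cauchy x) (cauchy y))

0ℝ : ℝ
0ℝ = fromℚ 0ℚ

fromℕ : ℕ → ℝ
fromℕ n = fromℚ (+ n ℚ./ 1)

1/ℝ : (n : ℕ) → .{{NonZero n}} → ℝ
1/ℝ n = fromℚ (+ 1 ℚ./ n)

------------------------------------------------------------------------
-- Accessibility

ℕ₊ : Set
ℕ₊ = [ n ∈ ℕ ∣ 0 ℕ.< n ]

suc₊ : ℕ₊ → ℕ₊
suc₊ (n , _) = suc n , Irrelevant.[ ℕ.z<s ]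

r∸1≢0 : ∀ {r} → 2 ℕ.≤ r → NonZero (r ℕ.∸ 1)
r∸1≢0 2≤r = ℕ.>-nonZero (ℕ.m<n⇒0<n∸m 2≤r)

-- D = { d 1 < d 2 < d 3 < ⋯ }
record _IncreasinglyEnumerates_ (d : ℕ₊ → ℕ₊) (D : Pred ℕ₊ ℓ) : Set ℓ where
  field
    increasing : ∀ {m n} → value m ℕ.< value n → value (d m) ℕ.< value (d n)
    sound      : ∀ n → d n ∈ D
    complete   : ∀ {x} → x ∈ D → ∃[ n ] d n ≡ x

Coloring : ∀ {a} → ℕ → Set a → Set a
Coloring r A = A → Fin r

IsDiffsequence : Pred ℕ₊ ℓ → ∀ {k} → Vector ℤ k → Set ℓ
IsDiffsequence D x = ∀ i j → toℕ j ≡ suc (toℕ i) →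
  ∃[ d ] d ∈ D × x j ℤ.- x i ≡ + value d

Monochromatic : ∀ {a} {A : Set a} {r k} → Coloring r A → Vector A k → Set
Monochromatic χ x = ∃[ c ] (∀ i → χ (x i) ≡ c)

_-Accessible_ : ℕ → Pred ℕ₊ ℓ → Set ℓ
r -Accessible D = (χ : Coloring r ℕ₊) → ∀ k → 1 ℕ.≤ k →
  ∃[ x ] IsDiffsequence D {k} (+_ ∘ value ∘ x) × Monochromatic χ x

-- "doa D = v", with ⊤⁺ as ∞.  A relation rather than a function, because the
-- greatest r is not computable from D.
IsDoa : Pred ℕ₊ ℓ → ℕ ⁺ → Set ℓ
IsDoa D [ r ] = 1 ℕ.≤ r × r -Accessible D ×
  (∀ s → 1 ℕ.≤ s → s -Accessible D → s ℕ.≤ r)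
IsDoa D ⊤⁺    = ∀ r → 1 ℕ.≤ r → r -Accessible D

-- "doa D ≤ m"
DoaAtMost : Pred ℕ₊ ℓ → ℕ → Set ℓ
DoaAtMost D m = ∀ v → IsDoa D v → v ≤⁺ [ m ]

{-# OPTIONS --safe #-}
module Submission where

-- Choose a real α such that every step α d (d ∈ D) lies, modulo 1, strictly
-- between 0 and 1 - 1/r by fixed margins, and color x by which of the r arcs
-- [i/r, (i+1)/r) contains the fractional part of α x.  A step that starts and
-- ends in the same arc cannot have gone around the circle, so it moves forward
-- within the arc by at least the margin; hence monochromatic diffsequences have
-- bounded length.  Such an α exists as the common point of nested intervals: if
-- α dₙ is free to range over a window of length ℓ, then α dₙ₊₁ ranges over an
-- interval of length ℓ dₙ₊₁/dₙ, which contains an integer translate of the window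
-- as soon as ℓ (dₙ₊₁/dₙ - 1) ≥ 1, and the growth hypothesis provides this for some
-- ℓ < 1 - 1/r.  The finitely many d before the growth starts cause no trouble,
-- because the first interval is chosen so close to 0 that their steps do not wrap.
-- To stay computable, α x is evaluated with a rational approximation of α
-- depending on x; the resulting bounded error fits into the margins.

open import Defs
open import Data.Fin.Base as Fin using (Fin; zero; suc; toℕ; inject₁; inject≤)
open import Data.Fin.Induction using (<-weakInduction)
open import Data.Fin.Properties
  using (toℕ-fromℕ; fromℕ<-injective; toℕ-inject₁; inject≤-injective)
import Data.Integer.Base as ℤ
open ℤ using (+_; +[1+_])
import Data.Integer.Properties as ℤ
open import Data.Irrelevant as Irrelevant using ()
open import Data.Nat.Base
open import Data.Nat.DivMod
open import Data.Nat.Divisibility using (_∣_; divides; ∣m+n∣m⇒∣n; n∣m*n; ∣⇒≤)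
open import Data.Nat.Properties
open import Data.Nat.Tactic.RingSolver using (solve-∀)
open import Data.Product.Base using (Σ-syntax; ∃-syntax; _×_; _,_; proj₁; proj₂)
import Data.Rational.Base as ℚ
open ℚ using (ℚ; mkℚ; 0ℚ)
import Data.Rational.Properties as ℚ
open import Data.Rational.Solver using (module +-*-Solver)
import Data.Rational.Unnormalised.Base as ℚᵘ
open ℚᵘ using (ℚᵘ; mkℚᵘ)
import Data.Rational.Unnormalised.Properties as ℚᵘ
open import Data.Refinement.Base using (value; _,_)
open import Data.Sum.Base using (inj₁; inj₂)
open import Level using (Level)
open import Relation.Binary.Construct.Add.Supremum.NonStrict _≤_ using ([_])
open import Relation.Binary.PropositionalEquality
  using (_≡_; refl; sym; trans; cong; subst; module ≡-Reasoning)
open import Relation.Nullary.Construct.Add.Supremum using ([_]; ⊤⁺)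
open import Relation.Nullary.Decidable.Core using (yes; no)
open import Relation.Nullary.Negation.Core using (¬_; contradiction)
open import Relation.Unary using (Pred; _∈_)

-- Fractions, residues and arcs of a circle

-- Transitivity along `a / u ≤ b / v ≤ c / w`, cross-multiplied; the interval estimates for α are
-- chained with it.
≤-ratio-trans : ∀ {a b c u v w} .{{_ : NonZero v}} →
  a * v ≤ b * u → b * w ≤ c * v → a * w ≤ c * u
≤-ratio-trans {a} {b} {c} {u} {v} {w} av≤bu bw≤cv = *-cancelʳ-≤ _ _ v (begin
  a * w * v  ≡⟨ xyz≡xzy a w v ⟩
  a * v * w  ≤⟨ *-monoˡ-≤ w av≤bu ⟩
  b * u * w  ≡⟨ xyz≡xzy b u w ⟩
  b * w * u  ≤⟨ *-monoˡ-≤ u bw≤cv ⟩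
  c * v * u  ≡⟨ xyz≡xzy c v u ⟩
  c * u * v  ∎)
  where
  open ≤-Reasoning
  xyz≡xzy : ∀ x y z → x * y * z ≡ x * z * y
  xyz≡xzy = solve-∀

m<[1+m/n]*n : ∀ m n .{{_ : NonZero n}} → m < suc (m / n) * n
m<[1+m/n]*n m n = begin-strict
  m                  ≡⟨ m≡m%n+[m/n]*n m n ⟩
  m % n + m / n * n  <⟨ +-monoˡ-< (m / n * n) (m%n<n m n) ⟩
  n + m / n * n      ∎
  where open ≤-Reasoning

%≡⇒∣ : ∀ a t r .{{_ : NonZero r}} → a % r ≡ (a + t) % r → r ∣ t
%≡⇒∣ a t r eq = ∣m+n∣m⇒∣n (divides ((a + t) / r) (+-cancelˡ-≡ (a % r) _ _ (begin
  a % r + (a / r * r + t)          ≡⟨ +-assoc (a % r) (a / r * r) t ⟨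
  a % r + a / r * r + t            ≡⟨ cong (_+ t) (m≡m%n+[m/n]*n a r) ⟨
  a + t                            ≡⟨ m≡m%n+[m/n]*n (a + t) r ⟩
  (a + t) % r + (a + t) / r * r    ≡⟨ cong (_+ (a + t) / r * r) eq ⟨
  a % r + (a + t) / r * r          ∎))) (n∣m*n (a / r))
  where open ≡-Reasoning

-- A circle of r = 1 + s arcs of length L: a forward move by at most s * L
-- cannot re-enter the arc it started from.
advance-in-arc : ∀ s L .{{_ : NonZero L}} {u v} → u < v → v ≤ u + s * L →
  (u / L) % suc s ≡ (v / L) % suc s → u % L < v % L
advance-in-arc s L {u} {v} u<v v≤u+sL same = +-cancelʳ-< (u / L * L) _ _ (begin-strict
  u % L + u / L * L  ≡⟨ m≡m%n+[m/n]*n u L ⟨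
  u                  <⟨ u<v ⟩
  v                  ≡⟨ m≡m%n+[m/n]*n v L ⟩
  v % L + v / L * L  ≡⟨ cong (λ z → v % L + z * L) v/L≡u/L ⟩
  v % L + u / L * L  ∎)
  where
  open ≤-Reasoning
  t : ℕ
  t = v / L ∸ u / L
  u/L+t≡v/L : u / L + t ≡ v / L
  u/L+t≡v/L = m+[n∸m]≡n (/-monoˡ-≤ L (<⇒≤ u<v))
  t≤s : t ≤ s
  t≤s = +-cancelˡ-≤ (u / L) _ _ (begin
    u / L + t              ≡⟨ u/L+t≡v/L ⟩
    v / L                  ≤⟨ /-monoˡ-≤ L v≤u+sL ⟩
    (u + s * L) / L        ≡⟨ +-distrib-/-∣ʳ u (n∣m*n s) ⟩
    u / L + (s * L) / L    ≡⟨ cong (λ z → u / L + z) (m*n/n≡m s L) ⟩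
    u / L + s              ∎)
  multiple-below : ∀ {n} → n ≤ s → suc s ∣ n → n ≡ 0
  multiple-below {zero}  _   _ = refl
  multiple-below {suc n} n≤s d = contradiction (≤-trans (∣⇒≤ d) n≤s) 1+n≰n
  v/L≡u/L : v / L ≡ u / L
  v/L≡u/L = begin-equality
    v / L      ≡⟨ u/L+t≡v/L ⟨
    u / L + t  ≡⟨ cong (λ z → u / L + z) (multiple-below t≤s (%≡⇒∣ (u / L) t (suc s)
                    (trans same (cong (_% suc s) (sym u/L+t≡v/L))))) ⟩
    u / L + 0  ≡⟨ +-identityʳ _ ⟩
    u / L      ∎

-- The `k` full turns are absorbed into the starting point, which changes neither its arc nor its
-- offset within the arc.
advance-around-circle : ∀ s L .{{_ : NonZero L}} {u v} k →
  u + k * (suc s * L) < v → v ≤ u + k * (suc s * L) + s * L →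
  (u / L) % suc s ≡ (v / L) % suc s → u % L < v % L
advance-around-circle s L {u} {v} k lo hi same =
  subst (_< v % L) (trans (cong (_% L) u′≡) ([m+kn]%n≡m%n u (k * suc s) L))
    (advance-in-arc s L lo hi (trans same′ same))
  where
  open ≡-Reasoning
  u′ : ℕ
  u′ = u + k * (suc s * L)
  u′≡ : u′ ≡ u + k * suc s * L
  u′≡ = cong (λ z → u + z) (sym (*-assoc k (suc s) L))
  same′ : (u′ / L) % suc s ≡ (u / L) % suc s
  same′ = begin
    (u′ / L) % suc s                           ≡⟨ cong (λ z → (z / L) % suc s) u′≡ ⟩
    ((u + k * suc s * L) / L) % suc s          ≡⟨ cong (_% suc s) (+-distrib-/-∣ʳ u (n∣m*n (k * suc s))) ⟩
    (u / L + (k * suc s * L) / L) % suc s      ≡⟨ cong (λ z → (u / L + z) % suc s) (m*n/n≡m (k * suc s) L) ⟩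
    (u / L + k * suc s) % suc s                ≡⟨ [m+kn]%n≡m%n (u / L) k (suc s) ⟩
    (u / L) % suc s                            ∎

-- This places the next translate of the window: shifting `z / e` by `c ∸ a` and rounding down to a
-- multiple of `c` yields `k`.
residue-above : ∀ z c a e .{{_ : NonZero c}} .{{_ : NonZero e}} → a ≤ c →
  ∃[ k ] z ≤ (k * c + a) * e × (k * c + a) * e ≤ z + c * e
residue-above z c a e a≤c = k , lower , upper
  where
  open ≤-Reasoning
  instance
    _ = m*n≢0 c e
  y k : ℕ
  y = z + (c ∸ a) * e
  k = y / (c * e)
  split : (c ∸ a) * e + a * e ≡ c * e
  split = trans (sym (*-distribʳ-+ e (c ∸ a) a)) (cong (_* e) (m∸n+n≡m a≤c))
  expand : (k * c + a) * e ≡ k * (c * e) + a * e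
  expand = trans (*-distribʳ-+ e (k * c) a) (cong (_+ a * e) (*-assoc k c e))
  lower : z ≤ (k * c + a) * e
  lower = +-cancelʳ-≤ ((c ∸ a) * e) _ _ (<⇒≤ (begin-strict
    y                                          <⟨ m<[1+m/n]*n y (c * e) ⟩
    c * e + k * (c * e)                        ≡⟨ +-comm (c * e) _ ⟩
    k * (c * e) + c * e                        ≡⟨ cong (λ z → k * (c * e) + z) (trans (sym split) (+-comm _ (a * e))) ⟩
    k * (c * e) + (a * e + (c ∸ a) * e)        ≡⟨ +-assoc (k * (c * e)) _ _ ⟨
    k * (c * e) + a * e + (c ∸ a) * e          ≡⟨ cong (_+ (c ∸ a) * e) expand ⟨
    (k * c + a) * e + (c ∸ a) * e              ∎))
  upper : (k * c + a) * e ≤ z + c * e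
  upper = begin
    (k * c + a) * e                  ≡⟨ expand ⟩
    k * (c * e) + a * e              ≤⟨ +-monoˡ-≤ (a * e) (m/n*n≤m y (c * e)) ⟩
    z + (c ∸ a) * e + a * e          ≡⟨ +-assoc z _ _ ⟩
    z + ((c ∸ a) * e + a * e)        ≡⟨ cong (λ y → z + y) split ⟩
    z + c * e                        ∎

increasing⇒n≤f[n] : ∀ (f : ℕ → ℕ) → (∀ n → f n < f (suc n)) → ∀ n → n ≤ f n
increasing⇒n≤f[n] f f< zero    = z≤n
increasing⇒n≤f[n] f f< (suc n) = <-≤-trans (s<s (increasing⇒n≤f[n] f f< n)) (f< n)

increasing⇒mono : ∀ (f : ℕ → ℕ) → (∀ n → f n < f (suc n)) → ∀ {m n} → m ≤′ n → f m ≤ f n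
increasing⇒mono f f< ≤′-refl         = ≤-refl
increasing⇒mono f f< (≤′-step m≤′n) = ≤-trans (increasing⇒mono f f< m≤′n) (<⇒≤ (f< _))

-- The coloring of a lacunary sequence

-- The growth hypothesis is E (1 + j) ≥ (2 + 1/s + 1/q) E j with the denominators
-- cleared, where r = 1 + s.
module LacunaryColoring
  (s q : ℕ) .{{_ : NonZero s}} .{{_ : NonZero q}}
  (E : ℕ → ℕ) .{{E≢0 : ∀ {n} → NonZero (E n)}} (E< : ∀ n → E n < E (suc n))
  (j₀ : ℕ)
  (growth : ∀ j → j₀ ≤ j → (s * q + (q * suc s + s)) * E j ≤ s * q * E (suc j))
  where

  open ≤-Reasoning

  e : ℕ → ℕ
  e j = E (j + j₀)

  -- The circle is measured in units of which s * arc - window ≥ w, so that the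
  -- window [a , a + window] leaves 2 units of slack below s * arc.  Starting it at
  -- a = E j₀ makes α ≥ 1, so that every step is at least one unit long.
  a w T arc circumference window : ℕ
  a             = E j₀
  w             = 2 + a
  T             = q * suc s + s
  arc           = T * w
  circumference = suc s * arc
  window        = suc s * (s * q) * w

  instance
    T≢0 : NonZero T
    T≢0 = >-nonZero (<-≤-trans (>-nonZero⁻¹ s) (m≤n+m s (q * suc s)))
    arc≢0 : NonZero arc
    arc≢0 = m*n≢0 T w
    circumference≢0 : NonZero circumference
    circumference≢0 = m*n≢0 (suc s) arc

  a≤circumference : a ≤ circumference
  a≤circumference = begin
    a              ≤⟨ m≤n+m a 2 ⟩
    w              ≤⟨ m≤n*m w T ⟩
    arc            ≤⟨ m≤n*m arc (suc s) ⟩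
    circumference  ∎

  2+a+window≤s*arc : 2 + (a + window) ≤ s * arc
  2+a+window≤s*arc = begin
    w + window               ≤⟨ +-monoˡ-≤ window (m≤n*m w (s * s) {{m*n≢0 s s}}) ⟩
    s * s * w + window       ≡⟨ identity s q w ⟩
    s * arc                  ∎
    where
    identity : ∀ s q w →
      s * s * w + suc s * (s * q) * w ≡ s * ((q * suc s + s) * w)
    identity = solve-∀

  -- Nested intervals for α

  -- The j-th interval for α is [h j / e j , (h j + window) / e j].
  turns : ℕ → ℕ
  h : ℕ → ℕ
  next : ∀ j → ∃[ k ] h j * e (suc j) ≤ (k * circumference + a) * e j
    × (k * circumference + a) * e j ≤ h j * e (suc j) + circumference * e j
  turns zero    = 0
  turns (suc j) = proj₁ (next j)
  h j = turns j * circumference + a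
  next j = residue-above (h j * e (suc j)) circumference a (e j) a≤circumference

  -- The ratio of `window` to `circumference` is `s * q` to `T`, chosen so that
  -- `(circumference + window) / window` is exactly the guaranteed growth factor.
  room : ∀ j → circumference * e j + window * e j ≤ window * e (suc j)
  room j = begin
    circumference * e j + window * e j           ≡⟨ identity s q w (e j) ⟩
    suc s * w * ((s * q + T) * e j)              ≤⟨ *-monoʳ-≤ (suc s * w) (growth (j + j₀) (m≤n+m j₀ j)) ⟩
    suc s * w * (s * q * e (suc j))              ≡⟨ identity′ (suc s) w (s * q) (e (suc j)) ⟩
    window * e (suc j)                           ∎
    where
    identity : ∀ s q w x →
      suc s * ((q * suc s + s) * w) * x + suc s * (s * q) * w * x
        ≡ suc s * w * ((s * q + (q * suc s + s)) * x)
    identity = solve-∀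
    identity′ : ∀ r w p x → r * w * (p * x) ≡ r * p * w * x
    identity′ = solve-∀

  lower-mono : ∀ {m n} → m ≤′ n → h m * e n ≤ h n * e m
  lower-mono ≤′-refl = ≤-refl
  lower-mono {m} {suc n} (≤′-step m≤n) =
    ≤-ratio-trans {h m} {h n} {h (suc n)} {e m} {e n} {e (suc n)}
      (lower-mono m≤n) (proj₁ (proj₂ (next n)))

  -- Rounding up moves the left end by at most one `circumference`, and `room` leaves space for that
  -- and the new window.
  upper-step : ∀ n → (h (suc n) + window) * e n ≤ (h n + window) * e (suc n)
  upper-step n = begin
    (h (suc n) + window) * e n                                ≡⟨ *-distribʳ-+ (e n) (h (suc n)) window ⟩
    h (suc n) * e n + window * e n                            ≤⟨ +-monoˡ-≤ (window * e n) (proj₂ (proj₂ (next n))) ⟩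
    h n * e (suc n) + circumference * e n + window * e n      ≡⟨ +-assoc (h n * e (suc n)) _ _ ⟩
    h n * e (suc n) + (circumference * e n + window * e n)    ≤⟨ +-monoʳ-≤ (h n * e (suc n)) (room n) ⟩
    h n * e (suc n) + window * e (suc n)                      ≡⟨ *-distribʳ-+ (e (suc n)) (h n) window ⟨
    (h n + window) * e (suc n)                                ∎

  upper-anti : ∀ {m n} → m ≤′ n → (h n + window) * e m ≤ (h m + window) * e n
  upper-anti ≤′-refl = ≤-refl
  upper-anti {m} {suc n} (≤′-step m≤n) =
    ≤-ratio-trans {h (suc n) + window} {h n + window} {h m + window} {e (suc n)} {e n} {e m}
      (upper-step n) (upper-anti m≤n)

  -- This is α ≥ 1: the left end of the zeroth interval is `a / a`.
  e≤h : ∀ m → e m ≤ h m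
  e≤h m = *-cancelˡ-≤ a (begin
    a * e m  ≤⟨ lower-mono {0} {m} z≤′n ⟩
    h m * a  ≡⟨ *-comm (h m) a ⟩
    a * h m  ∎)

  -- Steps modulo the circumference

  -- With α replaced by the left end `h m / e m`, the step α x makes `k` full turns and then moves
  -- by between 1 and `a + window`.
  GoodStep : ℕ → ℕ → ℕ → Set
  GoodStep x k m =
    (k * circumference + 1) * e m ≤ h m * x ×
    h m * x ≤ (k * circumference + (a + window)) * e m

  large-step : ∀ j m → j ≤ m → GoodStep (e j) (turns j) m
  large-step j m j≤m = (begin
    (turns j * circumference + 1) * e m  ≤⟨ *-monoˡ-≤ (e m) (+-monoʳ-≤ (turns j * circumference) (>-nonZero⁻¹ a)) ⟩
    h j * e m                            ≤⟨ lower-mono (≤⇒≤′ j≤m) ⟩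
    h m * e j                            ∎) , (begin
    h m * e j                            ≤⟨ *-monoˡ-≤ (e j) (m≤m+n (h m) window) ⟩
    (h m + window) * e j                 ≤⟨ upper-anti (≤⇒≤′ j≤m) ⟩
    (h j + window) * e m                 ≡⟨ cong (_* e m) (+-assoc (turns j * circumference) a window) ⟩
    (turns j * circumference + (a + window)) * e m ∎)

  -- Since α is at most `(a + window) / a` and `E i ≤ a`, the step ends before completing a turn.
  small-step : ∀ i m → i ≤ j₀ → GoodStep (E i) 0 m
  small-step i m i≤j₀ = (begin
    1 * e m             ≡⟨ *-identityˡ (e m) ⟩
    e m                 ≤⟨ e≤h m ⟩
    h m                 ≤⟨ m≤m*n (h m) (E i) ⟩
    h m * E i           ∎) , (begin
    h m * E i           ≤⟨ *-mono-≤ (m≤m+n (h m) window) (increasing⇒mono E E< (≤⇒≤′ i≤j₀)) ⟩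
    (h m + window) * a  ≤⟨ upper-anti {0} {m} z≤′n ⟩
    (a + window) * e m  ∎)

  good-step : ∀ i m → i ≤ m → ∃[ k ] GoodStep (E i) k m
  good-step i m i≤m with ≤-total i j₀
  ... | inj₁ i≤j₀ = 0 , small-step i m i≤j₀
  ... | inj₂ j₀≤i = turns (i ∸ j₀) , subst (λ z → GoodStep (E z) (turns (i ∸ j₀)) m) (m∸n+n≡m j₀≤i)
                      (large-step (i ∸ j₀) m (≤-trans (m∸n≤m i j₀) i≤m))

  -- Positions and colors

  -- At this index the interval for α is so short that α x is known up to one unit.
  precision : ℕ → ℕ
  precision x = suc (window * x)

  position : ℕ → ℕ
  position x = h (precision x) * x / e (precision x)

  position-lower : ∀ x {m} → precision x ≤ m → position x * e m ≤ h m * x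
  position-lower x {m} p≤m =
    ≤-ratio-trans {position x} {h (precision x)} {h m} {x} {e (precision x)} {e m}
      (m/n*n≤m (h (precision x) * x) (e (precision x))) (lower-mono (≤⇒≤′ p≤m))

  -- One unit is lost to rounding down in `position`, the other to the width of the interval, as
  -- `window * x ≤ e (precision x)`.
  position-upper : ∀ x {m} → precision x ≤ m → h m * x ≤ (2 + position x) * e m
  position-upper x {m} p≤m =
    ≤-ratio-trans {h m} {h M + window} {2 + position x} {e m} {e M} {x}
      (≤-trans (*-monoˡ-≤ (e M) (m≤m+n (h m) window)) (upper-anti (≤⇒≤′ p≤m))) (begin
      (h M + window) * x                ≡⟨ *-distribʳ-+ x (h M) window ⟩
      h M * x + window * x              ≤⟨ +-mono-≤ (<⇒≤ (m<[1+m/n]*n (h M * x) (e M))) window*x≤e ⟩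
      suc (position x) * e M + e M      ≡⟨ +-comm _ (e M) ⟩
      (2 + position x) * e M            ∎)
    where
    M : ℕ
    M = precision x
    window*x≤e : window * x ≤ e M
    window*x≤e = begin
      window * x     ≤⟨ n≤1+n _ ⟩
      M              ≤⟨ m≤m+n M j₀ ⟩
      M + j₀         ≤⟨ increasing⇒n≤f[n] E E< (M + j₀) ⟩
      e M            ∎

  position-advance : ∀ x i → ∃[ k ]
    position x + k * circumference < position (x + E i) ×
    position (x + E i) ≤ position x + k * circumference + s * arc
  -- Both positions and the step are compared at this one index, which is at least `i` and at least
  -- `precision x`.
  position-advance x i with good-step i (precision (x + E i)) i≤m
    where
    i≤m : i ≤ precision (x + E i)
    i≤m = begin
      i                     ≤⟨ increasing⇒n≤f[n] E E< i ⟩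
      E i                   ≤⟨ m≤n+m (E i) x ⟩
      x + E i               ≤⟨ m≤n*m (x + E i) window {{m*n≢0 (suc s * (s * q)) w {{m*n≢0 (suc s) (s * q) {{_}} {{m*n≢0 s q}}}}}} ⟩
      window * (x + E i)    ≤⟨ n≤1+n _ ⟩
      precision (x + E i)   ∎
  ... | k , step-lower , step-upper = k , advance-lower , advance-upper
    where
    y m : ℕ
    y = x + E i
    m = precision y
    precision≤ : precision x ≤ m
    precision≤ = s≤s (*-monoʳ-≤ window (m≤m+n x (E i)))
    advance-lower : position x + k * circumference < position y
    advance-lower = s<s⁻¹ (*-cancelʳ-< (e m) _ _ (begin-strict
      suc (position x + k * circumference) * e m               ≡⟨ identity (position x) (k * circumference) (e m) ⟩
      position x * e m + (k * circumference + 1) * e m         ≤⟨ +-mono-≤ (position-lower x precision≤) step-lower ⟩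
      h m * x + h m * E i                                      ≡⟨ *-distribˡ-+ (h m) x (E i) ⟨
      h m * y                                                  <⟨ m<[1+m/n]*n (h m * y) (e m) ⟩
      suc (position y) * e m                                   ∎))
      where
      identity : ∀ p c z → suc (p + c) * z ≡ p * z + (c + 1) * z
      identity = solve-∀
    advance-upper : position y ≤ position x + k * circumference + s * arc
    advance-upper = begin
      position y
        ≤⟨ *-cancelʳ-≤ _ _ (e m) (begin
          -- The 2 units of error in `position x` are the slack left by `2+a+window≤s*arc`.
          position y * e m
            ≤⟨ m/n*n≤m (h m * y) (e m) ⟩
          h m * y
            ≡⟨ *-distribˡ-+ (h m) x (E i) ⟩
          h m * x + h m * E i
            ≤⟨ +-mono-≤ (position-upper x precision≤) step-upper ⟩
          (2 + position x) * e m + (k * circumference + (a + window)) * e m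
            ≡⟨ identity (position x) (k * circumference) (a + window) (e m) ⟩
          (position x + k * circumference + (2 + (a + window))) * e m ∎) ⟩
      position x + k * circumference + (2 + (a + window))
        ≤⟨ +-monoʳ-≤ (position x + k * circumference) 2+a+window≤s*arc ⟩
      position x + k * circumference + s * arc ∎
      where
      identity : ∀ p c b z → (2 + p) * z + (c + b) * z ≡ (p + c + (2 + b)) * z
      identity = solve-∀

  color : ℕ → Fin (suc s)
  color x = (position x / arc) mod suc s

  -- The offset within the arc is the bounded quantity that every monochromatic step raises.
  color-advance : ∀ x i → color x ≡ color (x + E i) →
    position x % arc < position (x + E i) % arc
  color-advance x i same =
    let k , lower , upper = position-advance x i
    in advance-around-circle s arc k lower upper
      (fromℕ<-injective _ _ (m%n<n (position x / arc) (suc s))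
        (m%n<n (position (x + E i) / arc) (suc s)) same)

-- Increasing chains and the degree of accessibility

chain-grows : ∀ {n} (f : Fin (suc n) → ℕ) →
  (∀ i j → toℕ j ≡ suc (toℕ i) → f i < f j) → ∀ i → toℕ i ≤ f i
chain-grows f f< = <-weakInduction (λ i → toℕ i ≤ f i) z≤n λ i i≤fi →
  ≤-<-trans (subst (_≤ f (inject₁ i)) (toℕ-inject₁ i) i≤fi)
    (f< (inject₁ i) (suc i) (cong suc (sym (toℕ-inject₁ i))))

accessible-anti : ∀ {ℓ} {D : Pred ℕ₊ ℓ} {r t} → r ≤ t → t -Accessible D → r -Accessible D
accessible-anti r≤t acc χ k 1≤k with acc (λ x → inject≤ (χ x) r≤t) k 1≤k
accessible-anti r≤t acc χ (suc k) 1≤k | x , diff , c , mono =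
  -- The color `c` lies in `Fin t`; the matching color in `Fin r` is read off the first term, which
  -- exists because the length is positive.
  x , diff , χ (x zero) , λ i → inject≤-injective r≤t r≤t _ _ (trans (mono i) (sym (mono zero)))

¬accessible⇒doaAtMost : ∀ {ℓ} {D : Pred ℕ₊ ℓ} {r} → 1 ≤ r →
  ¬ (r -Accessible D) → DoaAtMost D (r ∸ 1)
¬accessible⇒doaAtMost 1≤r ¬acc ⊤⁺ doa = contradiction (doa _ 1≤r) ¬acc
¬accessible⇒doaAtMost {r = suc r} 1≤r ¬acc [ v ] (_ , acc , _) with v ≤? r
... | yes v≤r = [ v≤r ]
... | no  v≰r = contradiction (accessible-anti (≰⇒> v≰r) acc) ¬acc

-- From integers, rationals and reals to natural numbers

m-n≡o⇒m≡n+o : ∀ m n o → + m ℤ.- + n ≡ + o → m ≡ n + o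
m-n≡o⇒m≡n+o m n o eq = ℤ.+-injective (begin
  + m                    ≡⟨ ℤ.+-identityʳ (+ m) ⟨
  + m ℤ.+ + 0            ≡⟨ cong (ℤ._+_ (+ m)) (ℤ.+-inverseˡ (+ n)) ⟨
  + m ℤ.+ (ℤ.- + n ℤ.+ + n) ≡⟨ ℤ.+-assoc (+ m) (ℤ.- + n) (+ n) ⟨
  (+ m ℤ.- + n) ℤ.+ + n  ≡⟨ cong (ℤ._+ + n) eq ⟩
  + o ℤ.+ + n            ≡⟨ ℤ.+-comm (+ o) (+ n) ⟩
  + (n + o)              ∎)
  where open ≡-Reasoning

ℕ₊-nonZero : ∀ (x : ℕ₊) → NonZero (value x)
ℕ₊-nonZero (zero  , Irrelevant.[ () ])
ℕ₊-nonZero (suc _ , _) = _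

-- A positive fraction has numerator at least 1, so its own denominator serves.
unitFractionBelow : ∀ ε → 0ℚ ℚ.< ε → ∃[ q ] + 1 ℚ./ suc q ℚ.≤ ε
unitFractionBelow ε 0<ε with ε | ℚ.positive 0<ε
... | mkℚ +[1+ a ] b _ | _ = b , ℚ.toℚᵘ-cancel-≤ (begin
  ℚ.toℚᵘ (+ 1 ℚ./ suc b)  ≃⟨ ℚ.toℚᵘ-fromℚᵘ (mkℚᵘ (+ 1) b) ⟩
  mkℚᵘ (+ 1) b            ≤⟨ ℚᵘ.*≤* (ℤ.+≤+ (*-monoˡ-≤ (suc b) (s≤s (z≤n {a})))) ⟩
  mkℚᵘ +[1+ a ] b         ∎)
  where open ℚᵘ.≤-Reasoning

-- Passing to unnormalised rationals keeps numerators and denominators explicit, so the order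
-- unfolds to a cross-multiplied inequality of integers.
clear-denominators : ∀ s q m n .{{_ : NonZero m}} .{{_ : NonZero n}} →
  (+ 2 ℚ./ 1 ℚ.+ + 1 ℚ./ suc s ℚ.+ + 1 ℚ./ suc q) ℚ.* (+ m ℚ./ 1) ℚ.≤ + n ℚ./ 1 →
  (suc s * suc q + (suc q * suc (suc s) + suc s)) * m ≤ suc s * suc q * n
clear-denominators s q m@(suc _) n@(suc _) le = begin
  (suc s * suc q + (suc q * suc (suc s) + suc s)) * m
    ≡⟨ identityˡ (suc s) (suc q) m ⟩
  ((2 * suc s + 1 * 1) * suc q + 1 * (1 * suc s)) * m * 1
    ≤⟨ ℤ.drop‿+≤+ (ℚᵘ.drop-*≤* unnormalised) ⟩
  n * (1 * suc s * suc q * 1)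
    ≡⟨ identityʳ (suc s) (suc q) n ⟩
  suc s * suc q * n ∎
  where
  toℚᵘ-/ : ∀ k d → ℚ.toℚᵘ (+ k ℚ./ suc d) ℚᵘ.≃ mkℚᵘ (+ k) d
  toℚᵘ-/ k d = ℚ.toℚᵘ-fromℚᵘ (mkℚᵘ (+ k) d)
  2+1/s+1/q : ℚᵘ
  2+1/s+1/q = mkℚᵘ (+ 2) 0 ℚᵘ.+ mkℚᵘ (+ 1) s ℚᵘ.+ mkℚᵘ (+ 1) q
  ratio-≃ : ℚ.toℚᵘ (+ 2 ℚ./ 1 ℚ.+ + 1 ℚ./ suc s ℚ.+ + 1 ℚ./ suc q) ℚᵘ.≃ 2+1/s+1/q
  ratio-≃ = ℚᵘ.≃-trans (ℚ.toℚᵘ-homo-+ (+ 2 ℚ./ 1 ℚ.+ + 1 ℚ./ suc s) (+ 1 ℚ./ suc q))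
    (ℚᵘ.+-cong (ℚᵘ.≃-trans (ℚ.toℚᵘ-homo-+ (+ 2 ℚ./ 1) (+ 1 ℚ./ suc s))
      (ℚᵘ.+-cong (toℚᵘ-/ 2 0) (toℚᵘ-/ 1 s))) (toℚᵘ-/ 1 q))
  product-≃ : ℚ.toℚᵘ ((+ 2 ℚ./ 1 ℚ.+ + 1 ℚ./ suc s ℚ.+ + 1 ℚ./ suc q) ℚ.* (+ m ℚ./ 1))
    ℚᵘ.≃ 2+1/s+1/q ℚᵘ.* mkℚᵘ (+ m) 0
  product-≃ = ℚᵘ.≃-trans
    (ℚ.toℚᵘ-homo-* (+ 2 ℚ./ 1 ℚ.+ + 1 ℚ./ suc s ℚ.+ + 1 ℚ./ suc q) (+ m ℚ./ 1))
    (ℚᵘ.*-cong ratio-≃ (toℚᵘ-/ m 0))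
  unnormalised : 2+1/s+1/q ℚᵘ.* mkℚᵘ (+ m) 0 ℚᵘ.≤ mkℚᵘ (+ n) 0
  unnormalised = ℚᵘ.≤-respˡ-≃ product-≃ (ℚᵘ.≤-respʳ-≃ (toℚᵘ-/ n 0) (ℚ.toℚᵘ-mono-≤ le))
  open ≤-Reasoning
  identityˡ : ∀ s q m →
    (s * q + (q * suc s + s)) * m ≡ ((2 * s + 1 * 1) * q + 1 * (1 * s)) * m * 1
  identityˡ = solve-∀
  identityʳ : ∀ s q n → n * (1 * s * q * 1) ≡ s * q * n
  identityʳ = solve-∀

-- The order on ℚ is decidable; if the conclusion failed, the rational gap `z ℚ.- y` would witness
-- the strict inequality that `≤ℝ` denies.
≤ℝ⇒≤ℚ : ∀ p δ m n ε → ∃[ M ] (∀ k → M ≤ k → ε ℚ.≤ seq δ k) →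
  (fromℚ p +ℝ δ) *ℝ fromℕ m ≤ℝ fromℕ n →
  (p ℚ.+ ε) ℚ.* (+ m ℚ./ 1) ℚ.≤ + n ℚ./ 1
≤ℝ⇒≤ℚ p δ m n ε (M , ε≤δ) x≤y with (p ℚ.+ ε) ℚ.* (+ m ℚ./ 1) ℚ.≤? + n ℚ./ 1
... | yes le = le
... | no  ≰  = contradiction (z ℚ.- y , 0<z-y , M , λ k M≤k → begin
    y ℚ.+ (z ℚ.- y)                      ≡⟨ +-minus y z ⟩
    z                                    ≤⟨ ℚ.*-monoʳ-≤-nonNeg (+ m ℚ./ 1) {{ℚ.normalize-nonNeg m 1}} (ℚ.+-monoʳ-≤ p (ε≤δ k M≤k)) ⟩
    (p ℚ.+ seq δ k) ℚ.* (+ m ℚ./ 1)      ∎) x≤y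
  where
  open ℚ.≤-Reasoning
  y z : ℚ
  y = + n ℚ./ 1
  z = (p ℚ.+ ε) ℚ.* (+ m ℚ./ 1)
  +-minus : ∀ y z → y ℚ.+ (z ℚ.- y) ≡ z
  +-minus = solve 2 (λ y z → y :+ (z :- y) := z) refl
    where open +-*-Solver
  0<z-y : 0ℚ ℚ.< z ℚ.- y
  0<z-y = subst (ℚ._< z ℚ.- y) (ℚ.+-inverseʳ y) (ℚ.+-monoˡ-< (ℚ.- y) (ℚ.≰⇒> ≰))

-- Lacunary sets are not accessible

module _ {ℓ} {D : Pred ℕ₊ ℓ} {d : ℕ₊ → ℕ₊} (enum : d IncreasinglyEnumerates D) where

  open _IncreasinglyEnumerates_ enum

  term : ℕ → ℕ
  term i = value (d (suc i , Irrelevant.[ z<s ]))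

  term-nonZero : ∀ {i} → NonZero (term i)
  term-nonZero {i} = ℕ₊-nonZero (d (suc i , Irrelevant.[ z<s ]))

  term-increasing : ∀ i → term i < term (suc i)
  term-increasing i = increasing (n<1+n (suc i))

  ∈⇒term : ∀ {x} → x ∈ D → ∃[ i ] term i ≡ value x
  ∈⇒term x∈D with complete x∈D
  ... | (suc i , _) , refl = i , refl
  ... | (zero , Irrelevant.[ () ]) , _

  module _ (s q j₀ : ℕ)
    (growth : ∀ j → j₀ ≤ j →
      (suc s * suc q + (suc q * suc (suc s) + suc s)) * term j ≤ suc s * suc q * term (suc j))
    where

    open LacunaryColoring (suc s) (suc q) term {{term-nonZero}} term-increasing j₀ growth

    lacunary⇒¬accessible : ¬ (suc (suc s) -Accessible D)
    -- Among `suc arc` terms the offset rises `arc` times, so the last offset would reach `arc`,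
    -- while every residue modulo `arc` is smaller.
    lacunary⇒¬accessible acc with acc (λ x → color (value x)) (suc arc) z<s
    ... | x , diff , c , mono = contradiction (m%n<n (position (value (x (Fin.fromℕ arc)))) arc)
            (≤⇒≯ (subst (_≤ φ (Fin.fromℕ arc)) (toℕ-fromℕ arc) (chain-grows φ φ< (Fin.fromℕ arc))))
      where
      φ : Fin (suc arc) → ℕ
      φ i = position (value (x i)) % arc
      φ< : ∀ i j → toℕ j ≡ suc (toℕ i) → φ i < φ j
      φ< i j j≡1+i with diff i j j≡1+i
      ... | δ , δ∈D , xj-xi≡δ with ∈⇒term δ∈D
      ... | k , term≡δ = subst (λ z → φ i < position z % arc) (sym xj≡)
              (color-advance (value (x i)) k
                (trans (mono i) (trans (sym (mono j)) (cong color xj≡))))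
        where
        xj≡ : value (x j) ≡ value (x i) + term k
        xj≡ = trans (m-n≡o⇒m≡n+o _ _ _ xj-xi≡δ)
          (cong (λ z → value (x i) + z) (sym term≡δ))

theorem1 : ∀ {ℓ : Level} (r : ℕ) (2≤r : 2 ≤ r)
    (D : Pred ℕ₊ ℓ) (d : ℕ₊ → ℕ₊) → d IncreasinglyEnumerates D →
    (Σ[ δ ∈ ℝ ] 0ℝ <ℝ δ × (Σ[ N ∈ ℕ₊ ] (∀ (n : ℕ₊) → value N ≤ value n →
    (fromℕ 2 +ℝ 1/ℝ (r ∸ 1) {{r∸1≢0 2≤r}} +ℝ δ) *ℝ fromℕ (value (d n))
    ≤ℝ fromℕ (value (d (suc₊ n)))))) →
    ¬ (r -Accessible D) × DoaAtMost D (r ∸ 1)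
theorem1 (suc (suc s)) (s≤s (s≤s _)) D d enum (δ , (ε , 0<ε , M , ε≤δ) , N , growth) =
  ¬acc , ¬accessible⇒doaAtMost z<s ¬acc
  where
  -- The witness `ε` of `0ℝ <ℝ δ` is replaced by a unit fraction, the form of growth excess that the
  -- coloring uses.
  q : ℕ
  q = proj₁ (unitFractionBelow ε 0<ε)
  1/q≤δ : ∀ k → M ≤ k → + 1 ℚ./ suc q ℚ.≤ seq δ k
  1/q≤δ k M≤k = ℚ.≤-trans (proj₂ (unitFractionBelow ε 0<ε))
    (subst (ℚ._≤ seq δ k) (ℚ.+-identityˡ ε) (ε≤δ k M≤k))
  ¬acc : ¬ (suc (suc s) -Accessible D)
  -- `term` counts from 0 and `d` from 1, so `term j` has index `suc j`, which is past `value N`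
  -- once `value N ≤ j`.
  ¬acc = lacunary⇒¬accessible enum s q (value N) λ j N≤j →
    clear-denominators s q (term enum j) (term enum (suc j))
      {{term-nonZero enum}} {{term-nonZero enum}}
      (≤ℝ⇒≤ℚ (+ 2 ℚ./ 1 ℚ.+ + 1 ℚ./ suc s) δ (term enum j) (term enum (suc j)) (+ 1 ℚ./ suc q)
        (M , 1/q≤δ) (growth (suc j , Irrelevant.[ z<s ]) (≤-trans N≤j (n≤1+n j))))
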